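{- Let $T$ be an $n$-tournament with $n\geq 3$, and let $s(T)$ denote its simplicity index. For every integer $k$ the following statements hold: 1. if $n=4k+2$, then $s(T)\leq 2k$; 2. if $n=4k+1$, then $s(T)\leq 2k-1$; 3. if $n=4k$, then $s(T)\leq 2k-2$.
   Context: A tournament $T=(V,A)$ consists of a finite vertex set $V$ and a set $A$ of ordered pairs of distinct vertices (arcs) such that for all $x\neq y\in V$, $(x,y)\in A$ if and only if $(y,x)\notin A$. One writes $x\rightarrow y$ ($x$ dominates $y$) when $(x,y)\in A$. An $n$-tournament is a tournament with $n$ vertices. A module of $T$ is a subset $M\subseteq V$ such that for every $x\in V\setminus M$, either $m\rightarrow x$ for all $m\in M$, or $x\rightarrow m$ for all $m\in M$. The trivial modules are $\emptyset$, the singletons and $V$. An $n$-tournament is simple if $n\geq 3$ and all its modules are trivial. For an $n$-tournament $T$ with $n\geq 3$, the simplicity index $s(T)$ is the minimum number of arcs of $T$ whose reversal yields a non-simple tournament (so $s(T)=0$ if $T$ is not simple). -}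

module Defs where

open import Data.Bool.Base using (true)
open import Data.Bool.Properties using () renaming (_≟_ to _≟ᵇ_)
open import Data.Fin.Base using (Fin; zero; suc)
open import Data.Fin.Properties using (all?; any?) renaming (_≟_ to _≟ᶠ_)
open import Data.Fin.Subset using (Subset; _∈_; _∉_; ∁; ⊥; ⊤; ⁅_⁆; ∣_∣)
open import Data.Fin.Subset.Properties
  using (_∈?_; anySubset?; ∉⊥; ∈⊤; x∈⁅x⁆; x∈⁅y⁆⇒x≡y; x≢y⇒x∉⁅y⁆; x∈p⇒x∉∁p; x∉p⇒x∈∁p)
open import Data.Nat.Base using (ℕ; zero; suc; _≤_; _<_; z≤n; s≤s)
open import Data.Nat.Induction using (<-wellFounded)
open import Data.Nat.Properties using (_≤?_; ≮⇒≥; anyUpTo?) renaming (_≟_ to _≟ⁿ_)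
open import Data.Product.Base using (∃; ∃-syntax; _×_; _,_; proj₁; proj₂)
open import Data.Sum.Base using (_⊎_; inj₁; inj₂)
open import Data.Vec.Base using (Vec; []; _∷_; lookup; map; sum; tabulate)
open import Data.Vec.Properties using (lookup∘tabulate; []=⇒lookup; lookup⇒[]=; ≡-dec)
open import Function.Base using (_∘_)
open import Function.Bundles using (_⇔_; mk⇔; Equivalence)
open import Induction.WellFounded using (Acc; acc)
open import Level using (0ℓ)
open import Relation.Binary.Core using (Rel)
open import Relation.Binary.Definitions using () renaming (Decidable to Decidable₂)
open import Relation.Binary.PropositionalEquality
  using (_≡_; _≢_; refl; sym; trans; cong; subst; ≢-sym)
open import Relation.Nullary
  using (¬_; Dec; yes; no; does; contradiction; ¬?; map′; _×-dec_; _⊎-dec_; _→-dec_)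
open import Relation.Unary using (Pred; Decidable)

private variable
  n : ℕ

-- A set of ordered pairs of elements of Fin n, given row by row: the row of x
-- is the set of all y such that (x , y) belongs to the set.
PairSet : ℕ → Set
PairSet n = Vec (Subset n) n

infix 4 _∋_⟶_ _⊆ᵖ_

_∋_⟶_ : PairSet n → Fin n → Fin n → Set
A ∋ x ⟶ y = y ∈ lookup A x

_⊆ᵖ_ : PairSet n → PairSet n → Set
B ⊆ᵖ A = ∀ x y → B ∋ x ⟶ y → A ∋ x ⟶ y

size : PairSet n → ℕ
size B = sum (map ∣_∣ B)

record Tournament (n : ℕ) : Set where
  field
    arcs     : PairSet n
    distinct : ∀ {x y} → arcs ∋ x ⟶ y → x ≢ y
    oriented : ∀ {x y} → x ≢ y → arcs ∋ x ⟶ y ⇔ (¬ arcs ∋ y ⟶ x)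

open Tournament public

IsModule : Tournament n → Subset n → Set
IsModule T M = ∀ x → x ∉ M →
  (∀ m → m ∈ M → arcs T ∋ m ⟶ x) ⊎ (∀ m → m ∈ M → arcs T ∋ x ⟶ m)

Trivial : Subset n → Set
Trivial M = M ≡ ⊥ ⊎ (∃[ x ] M ≡ ⁅ x ⁆) ⊎ M ≡ ⊤

Simple : Tournament n → Set
Simple {n} T = 3 ≤ n × (∀ M → IsModule T M → Trivial M)

_∋?_⟶_ : (A : PairSet n) → Decidable₂ (A ∋_⟶_)
A ∋? x ⟶ y = y ∈? lookup A x

comprehension : {R : Rel (Fin n) 0ℓ} → Decidable₂ R → PairSet n
comprehension R? = tabulate λ x → tabulate λ y → does (R? x y)

module _ {R : Rel (Fin n) 0ℓ} (R? : Decidable₂ R) where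

  private
    entry : ∀ x y → lookup (lookup (comprehension R?) x) y ≡ does (R? x y)
    entry x y = trans (cong (λ r → lookup r y) (lookup∘tabulate _ x)) (lookup∘tabulate _ y)

  ∈-comprehension⁺ : ∀ {x y} → R x y → comprehension R? ∋ x ⟶ y
  ∈-comprehension⁺ {x} {y} r = lookup⇒[]= y _ (trans (entry x y) (holds (R? x y)))
    where
    holds : (d : Dec (R x y)) → does d ≡ true
    holds (yes _) = refl
    holds (no ¬r) = contradiction r ¬r

  ∈-comprehension⁻ : ∀ {x y} → comprehension R? ∋ x ⟶ y → R x y
  ∈-comprehension⁻ {x} {y} y∈ = holds (R? x y) (trans (sym (entry x y)) ([]=⇒lookup y∈))
    where
    holds : (d : Dec (R x y)) → does d ≡ true → R x y
    holds (yes r) _ = r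

ArcAfterReversal : PairSet n → PairSet n → Rel (Fin n) 0ℓ
ArcAfterReversal A B x y = (A ∋ x ⟶ y × ¬ B ∋ x ⟶ y) ⊎ B ∋ y ⟶ x

arcAfterReversal? : (A B : PairSet n) → Decidable₂ (ArcAfterReversal A B)
arcAfterReversal? A B x y = ((A ∋? x ⟶ y) ×-dec ¬? (B ∋? x ⟶ y)) ⊎-dec (B ∋? y ⟶ x)

reverse : (T : Tournament n) (B : PairSet n) → B ⊆ᵖ arcs T → Tournament n
reverse T B B⊆A = record
  { arcs     = comprehension after?
  ; distinct = distinct′ ∘ ∈-comprehension⁻ after?
  ; oriented = λ x≢y → mk⇔
      (λ xy yx → asym′ (∈-comprehension⁻ after? xy) (∈-comprehension⁻ after? yx))
      (λ ¬yx → ∈-comprehension⁺ after? (total′ x≢y (¬yx ∘ ∈-comprehension⁺ after?)))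
  }
  where
  A      = arcs T
  after? = arcAfterReversal? A B

  asym : ∀ {x y} → A ∋ x ⟶ y → ¬ A ∋ y ⟶ x
  asym xy∈A = Equivalence.to (oriented T (distinct T xy∈A)) xy∈A

  distinct′ : ∀ {x y} → ArcAfterReversal A B x y → x ≢ y
  distinct′ (inj₁ (xy∈A , _)) = distinct T xy∈A
  distinct′ (inj₂ yx∈B)       = ≢-sym (distinct T (B⊆A _ _ yx∈B))

  asym′ : ∀ {x y} → ArcAfterReversal A B x y → ¬ ArcAfterReversal A B y x
  asym′ (inj₁ (xy∈A , _)) (inj₁ (yx∈A , _)) = asym xy∈A yx∈A
  asym′ (inj₁ (_ , xy∉B)) (inj₂ xy∈B)       = xy∉B xy∈B
  asym′ (inj₂ yx∈B)       (inj₁ (_ , yx∉B)) = yx∉B yx∈B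
  asym′ (inj₂ yx∈B)       (inj₂ xy∈B)       = asym (B⊆A _ _ xy∈B) (B⊆A _ _ yx∈B)

  total′ : ∀ {x y} → x ≢ y → ¬ ArcAfterReversal A B y x → ArcAfterReversal A B x y
  total′ {x} {y} x≢y ¬yx with B ∋? x ⟶ y | B ∋? y ⟶ x
  ... | yes xy∈B | _        = contradiction (inj₂ xy∈B) ¬yx
  ... | no _     | yes yx∈B = inj₂ yx∈B
  ... | no xy∉B  | no yx∉B  =
    inj₁ (Equivalence.from (oriented T x≢y) (λ yx∈A → ¬yx (inj₁ (yx∈A , yx∉B))) , xy∉B)

ReversibleToNonSimple : Tournament n → ℕ → Set
ReversibleToNonSimple T s =
  ∃[ B ] ∃[ B⊆A ] size B ≡ s × ¬ Simple (reverse T B B⊆A)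

IsLeast : Pred ℕ 0ℓ → Pred ℕ 0ℓ
IsLeast P s = P s × (∀ t → P t → s ≤ t)

least : {P : Pred ℕ 0ℓ} → Decidable P → ∃ P → ∃ (IsLeast P)
least {P} P? (m , pm) = go m pm (<-wellFounded m)
  where
  go : ∀ m → P m → Acc _<_ m → ∃ (IsLeast P)
  go m pm (acc rec) with anyUpTo? P? m
  ... | yes (k , k<m , pk) = go k pk (rec k<m)
  ... | no ∄k              = m , pm , λ t pt → ≮⇒≥ (λ t<m → ∄k (t , t<m , pt))

allSubset? : {P : Pred (Subset n) 0ℓ} → Decidable P → Dec (∀ M → P M)
allSubset? {P = P} P? with anySubset? (¬? ∘ P?)
... | yes (M , ¬p) = no λ ∀p → ¬p (∀p M)
... | no ∄¬p       = yes prf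
  where
  prf : ∀ M → P M
  prf M with P? M
  ... | yes p = p
  ... | no ¬p = contradiction (M , ¬p) ∄¬p

anyRows? : ∀ {m} {P : Pred (Vec (Subset n) m) 0ℓ} → Decidable P → Dec (∃ P)
anyRows? {m = zero}  P? = map′ ([] ,_) (λ { ([] , p) → p }) (P? [])
anyRows? {m = suc m} P? =
  map′ (λ (r , rs , p) → r ∷ rs , p) (λ { (r ∷ rs , p) → r , rs , p })
    (anySubset? λ r → anyRows? λ rs → P? (r ∷ rs))

isModule? : (T : Tournament n) → Decidable (IsModule T)
isModule? T M = all? λ x → ¬? (x ∈? M) →-dec
  ((all? λ m → (m ∈? M) →-dec (arcs T ∋? m ⟶ x)) ⊎-dec
   (all? λ m → (m ∈? M) →-dec (arcs T ∋? x ⟶ m)))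

trivial? : Decidable (Trivial {n})
trivial? M = (M ≟ˢ ⊥) ⊎-dec (any? λ x → M ≟ˢ ⁅ x ⁆) ⊎-dec (M ≟ˢ ⊤)
  where _≟ˢ_ = ≡-dec _≟ᵇ_

simple? : Decidable (Simple {n})
simple? {n} T = (3 ≤? n) ×-dec allSubset? λ M → isModule? T M →-dec trivial? M

reversibleToNonSimple? : (T : Tournament n) → Decidable (ReversibleToNonSimple T)
reversibleToNonSimple? T s = anyRows? λ B →
  decide B (all? λ x → all? λ y → (B ∋? x ⟶ y) →-dec (arcs T ∋? x ⟶ y))
  where
  decide : ∀ B → Dec (B ⊆ᵖ arcs T) →
           Dec (∃[ B⊆A ] size B ≡ s × ¬ Simple (reverse T B B⊆A))
  decide B (no B⊈A)  = no λ (B⊆A , _) → B⊈A B⊆A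
  decide B (yes B⊆A) = map′ (B⊆A ,_) proj₂
    ((size B ≟ⁿ s) ×-dec ¬? (simple? (reverse T B B⊆A)))

-- Reversing every arc out of one vertex turns the complement of that vertex
-- into a nontrivial module, so the minimum defining the index exists.
reversibleToNonSimple : (T : Tournament n) → 3 ≤ n → ∃ (ReversibleToNonSimple T)
reversibleToNonSimple {n} T (s≤s (s≤s (s≤s z≤n))) =
  size B , B , B⊆A , refl , λ (_ , trivial) → nontrivial (trivial M isModule)
  where
  u v w : Fin n
  u = zero
  v = suc zero
  w = suc (suc zero)

  outArc? : Decidable₂ (λ x y → x ≡ u × arcs T ∋ x ⟶ y)
  outArc? x y = (x ≟ᶠ u) ×-dec (arcs T ∋? x ⟶ y)

  B : PairSet n
  B = comprehension outArc?

  B⊆A : B ⊆ᵖ arcs T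
  B⊆A x y xy∈B = proj₂ (∈-comprehension⁻ outArc? xy∈B)

  M : Subset n
  M = ∁ ⁅ u ⁆

  u∉M : u ∉ M
  u∉M = x∈p⇒x∉∁p (x∈⁅x⁆ u)

  ∈M : ∀ {y} → y ≢ u → y ∈ M
  ∈M y≢u = x∉p⇒x∈∁p (x≢y⇒x∉⁅y⁆ y≢u)

  dominates-u : ∀ y → y ≢ u → ArcAfterReversal (arcs T) B y u
  dominates-u y y≢u with arcs T ∋? u ⟶ y
  ... | yes uy∈A = inj₂ (∈-comprehension⁺ outArc? (refl , uy∈A))
  ... | no uy∉A  = inj₁ (Equivalence.from (oriented T y≢u) uy∉A ,
                         λ yu∈B → y≢u (proj₁ (∈-comprehension⁻ outArc? yu∈B)))

  isModule : IsModule (reverse T B B⊆A) M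
  isModule x x∉M with x ≟ᶠ u
  ... | no x≢u   = contradiction (∈M x≢u) x∉M
  ... | yes refl = inj₁ λ m m∈M → ∈-comprehension⁺ (arcAfterReversal? (arcs T) B)
                     (dominates-u m λ m≡u → u∉M (subst (_∈ M) m≡u m∈M))

  v≢w : v ≢ w
  v≢w ()

  nontrivial : ¬ Trivial M
  nontrivial (inj₁ M≡⊥) = ∉⊥ (subst (v ∈_) M≡⊥ (∈M λ ()))
  nontrivial (inj₂ (inj₁ (x , M≡x))) = v≢w (trans
    (x∈⁅y⁆⇒x≡y x (subst (v ∈_) M≡x (∈M λ ())))
    (sym (x∈⁅y⁆⇒x≡y x (subst (w ∈_) M≡x (∈M λ ())))))
  nontrivial (inj₂ (inj₂ M≡⊤)) = u∉M (subst (u ∈_) (sym M≡⊤) ∈⊤)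

abstract
  leastReversal : (T : Tournament n) → 3 ≤ n → ∃ (IsLeast (ReversibleToNonSimple T))
  leastReversal T 3≤n = least (reversibleToNonSimple? T) (reversibleToNonSimple T 3≤n)

simplicityIndex : (T : Tournament n) → 3 ≤ n → ℕ
simplicityIndex T 3≤n = proj₁ (leastReversal T 3≤n)

simplicityIndex-isLeast : (T : Tournament n) (3≤n : 3 ≤ n) →
  IsLeast (ReversibleToNonSimple T) (simplicityIndex T 3≤n)
simplicityIndex-isLeast T 3≤n = proj₂ (leastReversal T 3≤n)

{-# OPTIONS --safe #-}

-- Reversing all arcs into or out of a vertex makes its complement a module, and
-- reversing the arcs between x and the vertices that separate x from y makes
-- {x , y} a module. So s(T) is at most every out-degree o, every in-degree i,
-- and every number σ(x , y) of vertices separating x ≠ y. Now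
--   Σ σ(x , y) = 2 Σ i(z) o(z)   (over ordered pairs; z separates i(z) o(z) unordered pairs),
--   σ(x , y) ≡ o(x) + o(y) + 1   (mod 2)   for x ≠ y.
-- If n = 4k + 2, some degree is at most 2k. If n = 4k + 1 and no degree is below
-- 2k, then T is regular, the average of σ is 2k, and every σ is odd, so some σ is
-- below 2k. If n = 4k and no degree is below 2k - 1, half of the vertices have
-- out-degree 2k and half 2k - 1. Were every σ at least 2k - 1, parity would make it
-- at least 2k on pairs of distinct out-degrees, and the average would be exceeded.
module Submission where

open import Defs
import Algebra.Properties.Semiring.Sum as Sum
open import Data.Bool.Base using (true; false; if_then_else_)
open import Data.Empty using (⊥)
open import Data.Fin.Base using (Fin; zero; suc)
open import Data.Fin.Properties using () renaming (_≟_ to _≟ᶠ_)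
open import Data.Fin.Subset using (Subset; _∈_; _∉_; _∪_; ∁; ⁅_⁆; ∣_∣)
open import Data.Fin.Subset.Properties
  using (∉⊥; ∈⊤; x∈⁅x⁆; x∈⁅y⁆⇒x≡y; x≢y⇒x∉⁅y⁆; x∈p⇒x∉∁p; x∉p⇒x∈∁p; x∈∁p⇒x∉p; x∈p∪q⁻; x∈p∪q⁺)
open import Data.Integer.Base using (ℤ; +_; -[1+_]; _+_; _-_; _*_; _≤_; +≤+)
open import Data.Integer.Properties as ℤₚ using (+-injective)
open import Data.Nat.Base as ℕ using (ℕ; zero; suc; z≤n; s≤s)
open import Data.Nat.Properties as ℕₚ
  using (+-*-semiring; ≤-refl; ≤-trans; ≤-reflexive; +-mono-≤; *-mono-≤)
open import Data.Nat.Tactic.RingSolver using (solve-∀)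
open import Data.Product.Base using (∃-syntax; _×_; _,_; proj₁; proj₂)
open import Data.Sum.Base using (_⊎_; inj₁; inj₂; [_,_]′)
open import Data.Vec.Base as Vec using (tabulate)
open import Data.Vec.Properties using (tabulate-∘)
open import Function.Base using (_∘_; const)
open import Function.Bundles using (Equivalence)
open import Relation.Binary.PropositionalEquality
  using (_≡_; _≢_; refl; sym; trans; cong; cong₂; subst; ≢-sym; module ≡-Reasoning)
open import Relation.Nullary using (¬_; Dec; yes; no; does; contradiction; _×-dec_; _⊎-dec_)
open import Relation.Unary using (Pred; Decidable)
open import Level using (0ℓ)

open Sum +-*-semiring using (sum; sum-cong-≗; sum-replicate-zero; ∑-distrib-+; ∑-comm;
  *-distribˡ-sum; *-distribʳ-sum)

private variable
  n : ℕ
  P : Set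

-- Finite sums

sum-mono : {f g : Fin n → ℕ} → (∀ x → f x ℕ.≤ g x) → sum f ℕ.≤ sum g
sum-mono {zero}  f≤g = z≤n
sum-mono {suc n} f≤g = +-mono-≤ (f≤g zero) (sum-mono (f≤g ∘ suc))

sum-const : ∀ n c → sum {n} (const c) ≡ n ℕ.* c
sum-const zero    c = refl
sum-const (suc n) c = cong (c ℕ.+_) (sum-const n c)

⟦_⟧ : Dec P → ℕ
⟦ d ⟧ = if does d then 1 else 0

⟦⟧≤ : (d : Dec P) {m : ℕ} → (P → 1 ℕ.≤ m) → ⟦ d ⟧ ℕ.≤ m
⟦⟧≤ (yes p) 1≤m = 1≤m p
⟦⟧≤ (no _)  _   = z≤n

1≤⟦⟧ : (d : Dec P) → P → 1 ℕ.≤ ⟦ d ⟧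
1≤⟦⟧ (yes _) _ = ≤-refl
1≤⟦⟧ (no ¬p) p = contradiction p ¬p

δᶠ : Fin n → Fin n → ℕ
δᶠ x y = ⟦ x ≟ᶠ y ⟧

δᶠ-off : {x y : Fin n} → x ≢ y → δᶠ x y ≡ 0
δᶠ-off {x = x} {y} x≢y with x ≟ᶠ y
... | yes x≡y = contradiction x≡y x≢y
... | no _    = refl

sum-δᶠ : (x : Fin n) (f : Fin n → ℕ) → sum (λ y → δᶠ x y ℕ.* f y) ≡ f x
sum-δᶠ {suc n} zero f = begin
  1 ℕ.* f zero ℕ.+ sum {n} (const 0)  ≡⟨ cong (1 ℕ.* f zero ℕ.+_) (sum-replicate-zero n) ⟩
  1 ℕ.* f zero ℕ.+ 0                  ≡⟨ ℕₚ.+-identityʳ _ ⟩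
  1 ℕ.* f zero                        ≡⟨ ℕₚ.*-identityˡ _ ⟩
  f zero                              ∎
  where open ≡-Reasoning
sum-δᶠ (suc x) f = sum-δᶠ x (f ∘ suc)

∣tabulate∣ : {Q : Pred (Fin n) 0ℓ} (Q? : Decidable Q) →
             ∣ tabulate (does ∘ Q?) ∣ ≡ sum (λ x → ⟦ Q? x ⟧)
∣tabulate∣ {zero}  Q? = refl
∣tabulate∣ {suc n} Q? with does (Q? zero)
... | true  = cong suc (∣tabulate∣ (Q? ∘ suc))
... | false = ∣tabulate∣ (Q? ∘ suc)

sum-tabulate : (f : Fin n → ℕ) → Vec.sum (tabulate f) ≡ sum f
sum-tabulate {zero}  f = refl
sum-tabulate {suc n} f = cong (f zero ℕ.+_) (sum-tabulate (f ∘ suc))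

size-comprehension : {R : Fin n → Fin n → Set} (R? : ∀ x y → Dec (R x y)) →
  size (comprehension R?) ≡ sum (λ x → sum (λ y → ⟦ R? x y ⟧))
size-comprehension R? = begin
  Vec.sum (Vec.map ∣_∣ (tabulate row))  ≡⟨ cong Vec.sum (tabulate-∘ ∣_∣ row) ⟨
  Vec.sum (tabulate (∣_∣ ∘ row))        ≡⟨ sum-tabulate (∣_∣ ∘ row) ⟩
  sum (∣_∣ ∘ row)                       ≡⟨ sum-cong-≗ (λ x → ∣tabulate∣ (R? x)) ⟩
  sum (λ x → sum (λ y → ⟦ R? x y ⟧))    ∎
  where
  open ≡-Reasoning
  row = λ x → tabulate λ y → does (R? x y)

sum-product : (f g : Fin n → ℕ) → sum (λ x → sum (λ y → f x ℕ.* g y)) ≡ sum f ℕ.* sum g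
sum-product f g = trans (sum-cong-≗ (λ x → sym (*-distribˡ-sum (f x) g))) (sym (*-distribʳ-sum (sum g) f))

-- The surplus `c` is passed explicitly, so that refuting an inequality between polynomials comes
-- down to one identity that the ring solver checks.
exceeds : ∀ {a b c} → a ≡ 1 ℕ.+ (b ℕ.+ c) → ¬ a ℕ.≤ b
exceeds {b = b} {c} refl 1+b+c≤b = ℕₚ.<-irrefl refl (≤-trans (s≤s (ℕₚ.m≤m+n b c)) 1+b+c≤b)

-- Nontrivial modules

vertex : 3 ℕ.≤ n → Fin n
vertex (s≤s _) = zero

-- `x` and `y` may coincide; two successive uses then yield two distinct vertices besides a given
-- one.
third : 3 ℕ.≤ n → (x y : Fin n) → ∃[ z ] z ≢ x × z ≢ y
third (s≤s (s≤s (s≤s _))) zero          zero          = suc zero , (λ ()) , (λ ())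
third (s≤s (s≤s (s≤s _))) zero          (suc zero)    = suc (suc zero) , (λ ()) , (λ ())
third (s≤s (s≤s (s≤s _))) zero          (suc (suc _)) = suc zero , (λ ()) , (λ ())
third (s≤s (s≤s (s≤s _))) (suc zero)    zero          = suc (suc zero) , (λ ()) , (λ ())
third (s≤s (s≤s (s≤s _))) (suc (suc _)) zero          = suc zero , (λ ()) , (λ ())
third (s≤s (s≤s (s≤s _))) (suc _)       (suc _)       = zero , (λ ()) , (λ ())

nontrivial-module⇒¬simple : (T : Tournament n) {M : Subset n} {x y z : Fin n} →
  IsModule T M → x ∈ M → y ∈ M → x ≢ y → z ∉ M → ¬ Simple T
nontrivial-module⇒¬simple T {M} {x} {y} {z} isMod x∈M y∈M x≢y z∉M (_ , trivial)
  with trivial M isMod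
... | inj₁ refl              = ∉⊥ x∈M
... | inj₂ (inj₁ (w , refl)) = x≢y (trans (x∈⁅y⁆⇒x≡y w x∈M) (sym (x∈⁅y⁆⇒x≡y w y∈M)))
... | inj₂ (inj₂ refl)       = z∉M ∈⊤

-- Degrees, paths of length two and separating vertices

module Reversal (T : Tournament n) (3≤n : 3 ℕ.≤ n) where

  private
    _⇒_ : Fin n → Fin n → Set
    x ⇒ y = arcs T ∋ x ⟶ y

    _⇒?_ : ∀ x y → Dec (x ⇒ y)
    _⇒?_ = arcs T ∋?_⟶_

    s : ℕ
    s = simplicityIndex T 3≤n

  arc : Fin n → Fin n → ℕ
  arc x y = ⟦ x ⇒? y ⟧

  outdegree indegree : Fin n → ℕ
  outdegree x = sum (λ y → arc x y)
  indegree  x = sum (λ y → arc y x)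

  -- The entries of the square of the adjacency matrix.
  paths : Fin n → Fin n → ℕ
  paths x y = sum (λ z → arc x z ℕ.* arc z y)

  -- A vertex separates `x` from `y` exactly when it is the middle of a path of length two between
  -- them, in one direction or the other.
  separators : Fin n → Fin n → ℕ
  separators x y = paths x y ℕ.+ paths y x

  asym : ∀ {x y} → x ⇒ y → ¬ y ⇒ x
  asym x⇒y = Equivalence.to (oriented T (distinct T x⇒y)) x⇒y

  total : ∀ {x y} → x ≢ y → ¬ x ⇒ y → y ⇒ x
  total x≢y ¬x⇒y = Equivalence.from (oriented T (≢-sym x≢y)) ¬x⇒y

  -- An arithmetic form of the tournament axioms: multiplying a summand by the left side splits a
  -- sum according to how two vertices are related.
  trichotomy : ∀ x y → δᶠ x y ℕ.+ (arc x y ℕ.+ arc y x) ≡ 1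
  trichotomy x y with x ≟ᶠ y | x ⇒? y | y ⇒? x
  ... | yes refl | yes xx | _      = contradiction refl (distinct T xx)
  ... | yes refl | _      | yes xx = contradiction refl (distinct T xx)
  ... | yes _    | no _   | no _   = refl
  ... | no _     | yes xy | yes yx = contradiction yx (asym xy)
  ... | no _     | yes _  | no _   = refl
  ... | no _     | no _   | yes _  = refl
  ... | no x≢y   | no ¬xy | no ¬yx = contradiction (total x≢y ¬xy) ¬yx

  -- Reversing the arcs between one vertex and a chosen set

  module Flip (u : Fin n) {Q : Pred (Fin n) 0ℓ} (Q? : Decidable Q) where

    -- `Q` selects the far ends of the arcs at `u` to be reversed, whatever their direction; this
    -- one shape covers all three kinds of reversal.
    Flipped : Fin n → Fin n → Set
    Flipped a b = a ⇒ b × ((a ≡ u × Q b) ⊎ (b ≡ u × Q a))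

    flipped? : ∀ a b → Dec (Flipped a b)
    flipped? a b = (a ⇒? b) ×-dec (((a ≟ᶠ u) ×-dec Q? b) ⊎-dec ((b ≟ᶠ u) ×-dec Q? a))

    B : PairSet n
    B = comprehension flipped?

    B⊆A : B ⊆ᵖ arcs T
    B⊆A x y = proj₁ ∘ ∈-comprehension⁻ flipped?

    T′ : Tournament n
    T′ = reverse T B B⊆A

    reversed : ∀ {x y} → Flipped y x → arcs T′ ∋ x ⟶ y
    reversed = ∈-comprehension⁺ (arcAfterReversal? (arcs T) B) ∘ inj₂ ∘ ∈-comprehension⁺ flipped?

    kept : ∀ {x y} → x ⇒ y → ¬ Flipped x y → arcs T′ ∋ x ⟶ y
    kept x⇒y ¬f = ∈-comprehension⁺ (arcAfterReversal? (arcs T) B)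
      (inj₁ (x⇒y , ¬f ∘ ∈-comprehension⁻ flipped?))

    kept-off : ∀ {x y} → x ≢ u → y ≢ u → x ⇒ y → arcs T′ ∋ x ⟶ y
    kept-off x≢u y≢u x⇒y =
      kept x⇒y λ { (_ , inj₁ (x≡u , _)) → x≢u x≡u ; (_ , inj₂ (y≡u , _)) → y≢u y≡u }

    -- The arcs at `u` are switched on `Q` and unchanged off it. Should `Q` hold at `u` itself, no
    -- harm is done, since there are no loops.
    u⟶ : ∀ {z} → (z ⇒ u × Q z) ⊎ (u ⇒ z × ¬ Q z) → arcs T′ ∋ u ⟶ z
    u⟶ (inj₁ (z⇒u , q)) = reversed (z⇒u , inj₂ (refl , q))
    u⟶ (inj₂ (u⇒z , ¬q)) = kept u⇒z λ
      { (_ , inj₁ (_ , q)) → ¬q q ; (_ , inj₂ (refl , _)) → distinct T u⇒z refl }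

    ⟶u : ∀ {z} → (u ⇒ z × Q z) ⊎ (z ⇒ u × ¬ Q z) → arcs T′ ∋ z ⟶ u
    ⟶u (inj₁ (u⇒z , q)) = reversed (u⇒z , inj₁ (refl , q))
    ⟶u (inj₂ (z⇒u , ¬q)) = kept z⇒u λ
      { (_ , inj₁ (refl , _)) → distinct T z⇒u refl ; (_ , inj₂ (_ , q)) → ¬q q }

    -- Each `z` in `Q` accounts for at most one reversed arc, because `trichotomy` allows only one
    -- of the two arcs between `u` and `z`. Here `g` counts the reversed arcs out of `u` and `h`
    -- those into `u`.
    size-B : size B ℕ.≤ sum (λ z → ⟦ Q? z ⟧)
    size-B = begin
      size B
        ≡⟨ size-comprehension flipped? ⟩
      sum (λ a → sum (λ b → ⟦ flipped? a b ⟧))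
        ≤⟨ sum-mono (λ a → sum-mono (λ b → entry a b)) ⟩
      sum (λ a → sum (λ b → δᶠ u a ℕ.* g b ℕ.+ δᶠ u b ℕ.* h a))
        ≡⟨ sum-cong-≗ (λ a → ∑-distrib-+ (λ b → δᶠ u a ℕ.* g b) (λ b → δᶠ u b ℕ.* h a)) ⟩
      sum (λ a → sum (λ b → δᶠ u a ℕ.* g b) ℕ.+ sum (λ b → δᶠ u b ℕ.* h a))
        ≡⟨ sum-cong-≗ (λ a → cong₂ ℕ._+_ (sym (*-distribˡ-sum (δᶠ u a) g)) (sum-δᶠ u (const (h a)))) ⟩
      sum (λ a → δᶠ u a ℕ.* sum g ℕ.+ h a)
        ≡⟨ ∑-distrib-+ (λ a → δᶠ u a ℕ.* sum g) h ⟩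
      sum (λ a → δᶠ u a ℕ.* sum g) ℕ.+ sum h
        ≡⟨ cong (ℕ._+ sum h) (sum-δᶠ u (const (sum g))) ⟩
      sum g ℕ.+ sum h
        ≡⟨ ∑-distrib-+ g h ⟨
      sum (λ z → g z ℕ.+ h z)
        ≤⟨ sum-mono (λ z → bound z) ⟩
      sum (λ z → ⟦ Q? z ⟧) ∎
      where
      open ℕₚ.≤-Reasoning

      g h : Fin n → ℕ
      g z = ⟦ Q? z ⟧ ℕ.* arc u z
      h z = ⟦ Q? z ⟧ ℕ.* arc z u

      entry : ∀ a b → ⟦ flipped? a b ⟧ ℕ.≤ δᶠ u a ℕ.* g b ℕ.+ δᶠ u b ℕ.* h a
      entry a b = ⟦⟧≤ (flipped? a b) λ
        { (a⇒b , inj₁ (refl , q)) → ≤-trans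
            (*-mono-≤ (1≤⟦⟧ (u ≟ᶠ u) refl) (*-mono-≤ (1≤⟦⟧ (Q? b) q) (1≤⟦⟧ (u ⇒? b) a⇒b)))
            (ℕₚ.m≤m+n _ _)
        ; (a⇒b , inj₂ (refl , q)) → ≤-trans
            (*-mono-≤ (1≤⟦⟧ (u ≟ᶠ u) refl) (*-mono-≤ (1≤⟦⟧ (Q? a) q) (1≤⟦⟧ (a ⇒? u) a⇒b)))
            (ℕₚ.m≤n+m _ _) }

      bound : ∀ z → g z ℕ.+ h z ℕ.≤ ⟦ Q? z ⟧
      bound z = begin
        g z ℕ.+ h z                              ≡⟨ ℕₚ.*-distribˡ-+ ⟦ Q? z ⟧ _ _ ⟨
        ⟦ Q? z ⟧ ℕ.* (arc u z ℕ.+ arc z u)       ≤⟨ ℕₚ.*-monoʳ-≤ ⟦ Q? z ⟧ (ℕₚ.m≤n+m _ (δᶠ u z)) ⟩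
        ⟦ Q? z ⟧ ℕ.* (δᶠ u z ℕ.+ (arc u z ℕ.+ arc z u)) ≡⟨ cong (⟦ Q? z ⟧ ℕ.*_) (trichotomy u z) ⟩
        ⟦ Q? z ⟧ ℕ.* 1                           ≡⟨ ℕₚ.*-identityʳ _ ⟩
        ⟦ Q? z ⟧                                 ∎

    index≤ : ¬ Simple T′ → s ℕ.≤ sum (λ z → ⟦ Q? z ⟧)
    index≤ ¬simple = ≤-trans
      (proj₂ (simplicityIndex-isLeast T 3≤n) (size B) (B , B⊆A , refl , ¬simple)) size-B

  -- Upper bounds on the index by degrees and separators

  ∁⁅u⁆-module⇒¬simple : ∀ u (T′ : Tournament n) → IsModule T′ (∁ ⁅ u ⁆) → ¬ Simple T′
  ∁⁅u⁆-module⇒¬simple u T′ isMod with third 3≤n u u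
  ... | v , v≢u , _ with third 3≤n u v
  ...   | w , w≢u , w≢v = nontrivial-module⇒¬simple T′ isMod
            (x∉p⇒x∈∁p (x≢y⇒x∉⁅y⁆ v≢u)) (x∉p⇒x∈∁p (x≢y⇒x∉⁅y⁆ w≢u)) (≢-sym w≢v)
            (x∈p⇒x∉∁p (x∈⁅x⁆ u))

  index≤outdegree : ∀ u → s ℕ.≤ outdegree u
  index≤outdegree u = index≤ (∁⁅u⁆-module⇒¬simple u T′ isMod)
    where
    open Flip u (u ⇒?_)
    isMod : IsModule T′ (∁ ⁅ u ⁆)
    isMod x x∉M with x ≟ᶠ u
    ... | no x≢u   = contradiction (x∉p⇒x∈∁p (x≢y⇒x∉⁅y⁆ x≢u)) x∉M
    ... | yes refl = inj₁ λ m m∈M → ⟶u (dominates m (λ { refl → x∈∁p⇒x∉p m∈M (x∈⁅x⁆ x) }))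
      where
      dominates : ∀ m → m ≢ u → (u ⇒ m × u ⇒ m) ⊎ (m ⇒ u × ¬ u ⇒ m)
      dominates m m≢u with u ⇒? m
      ... | yes u⇒m = inj₁ (u⇒m , u⇒m)
      ... | no ¬u⇒m = inj₂ (total (≢-sym m≢u) ¬u⇒m , ¬u⇒m)

  index≤indegree : ∀ u → s ℕ.≤ indegree u
  index≤indegree u = index≤ (∁⁅u⁆-module⇒¬simple u T′ isMod)
    where
    open Flip u (_⇒? u)
    isMod : IsModule T′ (∁ ⁅ u ⁆)
    isMod x x∉M with x ≟ᶠ u
    ... | no x≢u   = contradiction (x∉p⇒x∈∁p (x≢y⇒x∉⁅y⁆ x≢u)) x∉M
    ... | yes refl = inj₂ λ m m∈M → u⟶ (dominated m (λ { refl → x∈∁p⇒x∉p m∈M (x∈⁅x⁆ x) }))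
      where
      dominated : ∀ m → m ≢ u → (m ⇒ u × m ⇒ u) ⊎ (u ⇒ m × ¬ m ⇒ u)
      dominated m m≢u with m ⇒? u
      ... | yes m⇒u = inj₁ (m⇒u , m⇒u)
      ... | no ¬m⇒u = inj₂ (total m≢u ¬m⇒u , ¬m⇒u)

  -- `sep?` selects the vertices at which `u` and `y` disagree. Reversing the arcs between `u` and
  -- these vertices makes `u` a twin of `y`, so that the pair becomes a module.
  index≤separators : ∀ {x y} → x ≢ y → s ℕ.≤ separators x y
  index≤separators {u} {y} u≢y = begin
    s                                                        ≤⟨ index≤ ¬simple ⟩
    sum (λ z → ⟦ sep? z ⟧)                                   ≤⟨ sum-mono (λ z → bound z) ⟩
    sum (λ z → arc u z ℕ.* arc z y ℕ.+ arc y z ℕ.* arc z u)  ≡⟨ ∑-distrib-+ (λ z → arc u z ℕ.* arc z y) (λ z → arc y z ℕ.* arc z u) ⟩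
    separators u y                                           ∎
    where
    open ℕₚ.≤-Reasoning

    sep? : ∀ z → Dec ((u ⇒ z × z ⇒ y) ⊎ (y ⇒ z × z ⇒ u))
    sep? z = ((u ⇒? z) ×-dec (z ⇒? y)) ⊎-dec ((y ⇒? z) ×-dec (z ⇒? u))

    open Flip u sep?

    bound : ∀ z → ⟦ sep? z ⟧ ℕ.≤ arc u z ℕ.* arc z y ℕ.+ arc y z ℕ.* arc z u
    bound z = ⟦⟧≤ (sep? z)
      [ (λ (uz , zy) → ≤-trans (*-mono-≤ (1≤⟦⟧ (u ⇒? z) uz) (1≤⟦⟧ (z ⇒? y) zy)) (ℕₚ.m≤m+n _ _))
      , (λ (yz , zu) → ≤-trans (*-mono-≤ (1≤⟦⟧ (y ⇒? z) yz) (1≤⟦⟧ (z ⇒? u) zu)) (ℕₚ.m≤n+m _ _)) ]′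

    M : Subset n
    M = ⁅ u ⁆ ∪ ⁅ y ⁆

    u∈M : u ∈ M
    u∈M = x∈p∪q⁺ (inj₁ (x∈⁅x⁆ u))

    y∈M : y ∈ M
    y∈M = x∈p∪q⁺ {p = ⁅ u ⁆} (inj₂ (x∈⁅x⁆ y))

    on-M : {R : Fin n → Set} → R u → R y → ∀ m → m ∈ M → R m
    on-M {R} ru ry m m∈M =
      [ (λ m∈u → subst R (sym (x∈⁅y⁆⇒x≡y u m∈u)) ru)
      , (λ m∈y → subst R (sym (x∈⁅y⁆⇒x≡y y m∈y)) ry) ]′ (x∈p∪q⁻ ⁅ u ⁆ ⁅ y ⁆ m∈M)

    isMod : IsModule T′ M
    -- The untouched arc between `y` and `z` fixes the direction; the arc between `u` and `z` is
    -- reversed in the two cases where it disagrees, and kept in the other two.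
    isMod z z∉M with y ⇒? z | u ⇒? z
    ... | yes yz | yes uz = inj₁ (on-M
      (u⟶ (inj₂ (uz , [ (λ (_ , zy) → asym yz zy) , (λ (_ , zu) → asym uz zu) ]′)))
      (kept-off (≢-sym u≢y) (λ { refl → z∉M u∈M }) yz))
    ... | yes yz | no ¬uz = inj₁ (on-M
      (u⟶ (inj₁ (zu , inj₂ (yz , zu))))
      (kept-off (≢-sym u≢y) (λ { refl → z∉M u∈M }) yz))
      where zu = total (λ { refl → z∉M u∈M }) ¬uz
    ... | no ¬yz | yes uz = inj₂ (on-M
      (⟶u (inj₁ (uz , inj₁ (uz , zy))))
      (kept-off (λ { refl → z∉M u∈M }) (≢-sym u≢y) zy))
      where zy = total (λ { refl → z∉M y∈M }) ¬yz
    ... | no ¬yz | no ¬uz = inj₂ (on-M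
      (⟶u (inj₂ (zu , [ (λ (uz , _) → ¬uz uz) , (λ (yz , _) → ¬yz yz) ]′)))
      (kept-off (λ { refl → z∉M u∈M }) (≢-sym u≢y) zy))
      where
      zu = total (λ { refl → z∉M u∈M }) ¬uz
      zy = total (λ { refl → z∉M y∈M }) ¬yz

    ¬simple : ¬ Simple T′
    ¬simple with third 3≤n u y
    ... | z , z≢u , z≢y = nontrivial-module⇒¬simple T′ isMod u∈M y∈M u≢y
            λ z∈M → [ z≢u ∘ x∈⁅y⁆⇒x≡y u , z≢y ∘ x∈⁅y⁆⇒x≡y y ]′ (x∈p∪q⁻ ⁅ u ⁆ ⁅ y ⁆ z∈M)

  -- Double counting

  degrees : ∀ x → 1 ℕ.+ (outdegree x ℕ.+ indegree x) ≡ n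
  degrees x = begin
    1 ℕ.+ (outdegree x ℕ.+ indegree x)
      ≡⟨ cong₂ ℕ._+_ (sum-δᶠ x (const 1)) (∑-distrib-+ (arc x) (λ y → arc y x)) ⟨
    sum (λ y → δᶠ x y ℕ.* 1) ℕ.+ sum (λ y → arc x y ℕ.+ arc y x)
      ≡⟨ ∑-distrib-+ (λ y → δᶠ x y ℕ.* 1) (λ y → arc x y ℕ.+ arc y x) ⟨
    sum (λ y → δᶠ x y ℕ.* 1 ℕ.+ (arc x y ℕ.+ arc y x))
      ≡⟨ sum-cong-≗ (λ y → trans (cong (ℕ._+ (arc x y ℕ.+ arc y x)) (ℕₚ.*-identityʳ (δᶠ x y))) (trichotomy x y)) ⟩
    sum {n} (const 1)
      ≡⟨ sum-const n 1 ⟩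
    n ℕ.* 1
      ≡⟨ ℕₚ.*-identityʳ n ⟩
    n ∎
    where open ≡-Reasoning

  ∑outdegree≡∑indegree : sum outdegree ≡ sum indegree
  ∑outdegree≡∑indegree = ∑-comm arc

  -- A path of length two is determined by its middle vertex `z`, an in-neighbour of `z` and an
  -- out-neighbour of `z`.
  ∑paths : sum (λ x → sum (λ y → paths x y)) ≡ sum (λ z → indegree z ℕ.* outdegree z)
  ∑paths = begin
    sum (λ x → sum (λ y → sum (λ z → arc x z ℕ.* arc z y)))
      ≡⟨ sum-cong-≗ (λ x → ∑-comm (λ y z → arc x z ℕ.* arc z y)) ⟩
    sum (λ x → sum (λ z → sum (λ y → arc x z ℕ.* arc z y)))
      ≡⟨ ∑-comm (λ x z → sum (λ y → arc x z ℕ.* arc z y)) ⟩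
    sum (λ z → sum (λ x → sum (λ y → arc x z ℕ.* arc z y)))
      ≡⟨ sum-cong-≗ (λ z → sum-cong-≗ (λ x → sym (*-distribˡ-sum (arc x z) (arc z)))) ⟩
    sum (λ z → sum (λ x → arc x z ℕ.* outdegree z))
      ≡⟨ sum-cong-≗ (λ z → sym (*-distribʳ-sum (outdegree z) (λ x → arc x z))) ⟩
    sum (λ z → indegree z ℕ.* outdegree z) ∎
    where open ≡-Reasoning

  ∑separators : sum (λ x → sum (λ y → separators x y)) ≡ 2 ℕ.* sum (λ z → indegree z ℕ.* outdegree z)
  ∑separators = begin
    sum (λ x → sum (λ y → paths x y ℕ.+ paths y x))
      ≡⟨ sum-cong-≗ (λ x → ∑-distrib-+ (paths x) (λ y → paths y x)) ⟩
    sum (λ x → sum (λ y → paths x y) ℕ.+ sum (λ y → paths y x))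
      ≡⟨ ∑-distrib-+ (λ x → sum (λ y → paths x y)) (λ x → sum (λ y → paths y x)) ⟩
    sum (λ x → sum (λ y → paths x y)) ℕ.+ sum (λ x → sum (λ y → paths y x))
      ≡⟨ cong₂ ℕ._+_ ∑paths (trans (sym (∑-comm paths)) ∑paths) ⟩
    io ℕ.+ io
      ≡⟨ cong (io ℕ.+_) (ℕₚ.+-identityʳ io) ⟨
    2 ℕ.* io ∎
    where
    open ≡-Reasoning
    io = sum (λ z → indegree z ℕ.* outdegree z)

  commonOut : Fin n → Fin n → ℕ
  commonOut x y = sum (λ z → arc x z ℕ.* arc y z)

  -- The out-neighbours of `x` are sorted by their relation to `y`: equal to `y`, dominated by `y`,
  -- or dominating `y`.
  outdegree-split : ∀ x y → outdegree x ≡ arc x y ℕ.+ (commonOut x y ℕ.+ paths x y)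
  outdegree-split x y = begin
    sum (λ z → arc x z)
      ≡⟨ sum-cong-≗ (λ z → split z) ⟩
    sum (λ z → δᶠ y z ℕ.* arc x z ℕ.+ (arc x z ℕ.* arc y z ℕ.+ arc x z ℕ.* arc z y))
      ≡⟨ ∑-distrib-+ (λ z → δᶠ y z ℕ.* arc x z) (λ z → arc x z ℕ.* arc y z ℕ.+ arc x z ℕ.* arc z y) ⟩
    sum (λ z → δᶠ y z ℕ.* arc x z) ℕ.+ sum (λ z → arc x z ℕ.* arc y z ℕ.+ arc x z ℕ.* arc z y)
      ≡⟨ cong₂ ℕ._+_ (sum-δᶠ y (arc x)) (∑-distrib-+ (λ z → arc x z ℕ.* arc y z) (λ z → arc x z ℕ.* arc z y)) ⟩
    arc x y ℕ.+ (commonOut x y ℕ.+ paths x y) ∎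
    where
    open ≡-Reasoning

    expand : ∀ a e b c → a ℕ.* (e ℕ.+ (b ℕ.+ c)) ≡ e ℕ.* a ℕ.+ (a ℕ.* b ℕ.+ a ℕ.* c)
    expand = solve-∀

    split : ∀ z → arc x z ≡ δᶠ y z ℕ.* arc x z ℕ.+ (arc x z ℕ.* arc y z ℕ.+ arc x z ℕ.* arc z y)
    split z = begin
      arc x z                                                   ≡⟨ ℕₚ.*-identityʳ _ ⟨
      arc x z ℕ.* 1                                             ≡⟨ cong (arc x z ℕ.*_) (trichotomy y z) ⟨
      arc x z ℕ.* (δᶠ y z ℕ.+ (arc y z ℕ.+ arc z y))            ≡⟨ expand (arc x z) (δᶠ y z) (arc y z) (arc z y) ⟩
      δᶠ y z ℕ.* arc x z ℕ.+ (arc x z ℕ.* arc y z ℕ.+ arc x z ℕ.* arc z y) ∎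

  -- Adding `outdegree-split` for both orders counts the common out-neighbours twice, and exactly
  -- one of the two possible arcs between `x` and `y` is present.
  parity : ∀ {x y} → x ≢ y →
    outdegree x ℕ.+ outdegree y ≡ 1 ℕ.+ (2 ℕ.* commonOut x y ℕ.+ separators x y)
  parity {x} {y} x≢y = begin
    outdegree x ℕ.+ outdegree y
      ≡⟨ cong₂ ℕ._+_ (outdegree-split x y) (outdegree-split y x) ⟩
    (arc x y ℕ.+ (c ℕ.+ p)) ℕ.+ (arc y x ℕ.+ (commonOut y x ℕ.+ q))
      ≡⟨ cong (λ c′ → (arc x y ℕ.+ (c ℕ.+ p)) ℕ.+ (arc y x ℕ.+ (c′ ℕ.+ q)))
              (sum-cong-≗ (λ z → ℕₚ.*-comm (arc y z) (arc x z))) ⟩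
    (arc x y ℕ.+ (c ℕ.+ p)) ℕ.+ (arc y x ℕ.+ (c ℕ.+ q))
      ≡⟨ regroup (arc x y) (arc y x) c p q ⟩
    (arc x y ℕ.+ arc y x) ℕ.+ (2 ℕ.* c ℕ.+ (p ℕ.+ q))
      ≡⟨ cong (ℕ._+ (2 ℕ.* c ℕ.+ (p ℕ.+ q))) one-arc ⟩
    1 ℕ.+ (2 ℕ.* c ℕ.+ (p ℕ.+ q)) ∎
    where
    open ≡-Reasoning

    c p q : ℕ
    c = commonOut x y
    p = paths x y
    q = paths y x

    one-arc : arc x y ℕ.+ arc y x ≡ 1
    one-arc = subst (λ e → e ℕ.+ (arc x y ℕ.+ arc y x) ≡ 1) (δᶠ-off x≢y) (trichotomy x y)

    regroup : ∀ a b c p q → (a ℕ.+ (c ℕ.+ p)) ℕ.+ (b ℕ.+ (c ℕ.+ q))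
                          ≡ (a ℕ.+ b) ℕ.+ (2 ℕ.* c ℕ.+ (p ℕ.+ q))
    regroup = solve-∀

  -- Turns a pointwise lower bound on `separators` into an inequality between totals. Since
  -- `separators x x` vanishes, the slack `d` makes room for `b` on the diagonal, at a total cost of
  -- `n ℕ.* d`.
  ∑bound≤ : (b : Fin n → Fin n → ℕ) (d : ℕ) →
    (∀ x y → b x y ℕ.≤ separators x y ℕ.+ δᶠ x y ℕ.* d) →
    sum (λ x → sum (b x)) ℕ.≤ 2 ℕ.* sum (λ z → indegree z ℕ.* outdegree z) ℕ.+ n ℕ.* d
  ∑bound≤ b d b≤ = begin
    sum (λ x → sum (b x))
      ≤⟨ sum-mono (λ x → sum-mono (b≤ x)) ⟩
    sum (λ x → sum (λ y → separators x y ℕ.+ δᶠ x y ℕ.* d))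
      ≡⟨ sum-cong-≗ (λ x → trans (∑-distrib-+ (separators x) (λ y → δᶠ x y ℕ.* d))
                                 (cong (sum (separators x) ℕ.+_) (sum-δᶠ x (const d)))) ⟩
    sum (λ x → sum (separators x) ℕ.+ d)
      ≡⟨ ∑-distrib-+ (λ x → sum (separators x)) (const d) ⟩
    sum (λ x → sum (separators x)) ℕ.+ sum {n} (const d)
      ≡⟨ cong₂ ℕ._+_ ∑separators (sum-const n d) ⟩
    2 ℕ.* sum (λ z → indegree z ℕ.* outdegree z) ℕ.+ n ℕ.* d ∎
    where open ℕₚ.≤-Reasoning

  -- Order 4k + 1: the tournament would be regular

  module Regular (j : ℕ) (n≡ : n ≡ 4 ℕ.* j ℕ.+ 5) (q≤s : 2 ℕ.* j ℕ.+ 2 ℕ.≤ s) where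

    -- With k = j + 1 this is 2k, so n = 2q + 1; the assumption that the index is at least `q` is to
    -- be refuted.
    q : ℕ
    q = 2 ℕ.* j ℕ.+ 2

    o+i : ∀ x → outdegree x ℕ.+ indegree x ≡ q ℕ.+ q
    o+i x = ℕₚ.suc-injective (trans (degrees x) (trans n≡ (arith j)))
      where
      arith : ∀ j → 4 ℕ.* j ℕ.+ 5 ≡ 1 ℕ.+ ((2 ℕ.* j ℕ.+ 2) ℕ.+ (2 ℕ.* j ℕ.+ 2))
      arith = solve-∀

    q≤o : ∀ x → q ℕ.≤ outdegree x
    q≤o x = ≤-trans q≤s (index≤outdegree x)

    q≤i : ∀ x → q ℕ.≤ indegree x
    q≤i x = ≤-trans q≤s (index≤indegree x)

    o≡q : ∀ x → outdegree x ≡ q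
    o≡q x = ℕₚ.≤-antisym
      (ℕₚ.+-cancelʳ-≤ q _ _ (≤-trans (ℕₚ.+-monoʳ-≤ (outdegree x) (q≤i x)) (≤-reflexive (o+i x))))
      (q≤o x)

    i≡q : ∀ x → indegree x ≡ q
    i≡q x = ℕₚ.+-cancelˡ-≡ q _ _ (trans (cong (ℕ._+ indegree x) (sym (o≡q x))) (o+i x))

    -- Off the diagonal, `separators x y` is at least `q` and odd, whereas `q` is even, which gains
    -- one. On the diagonal the slack alone suffices.
    1+q≤ : ∀ x y → 1 ℕ.+ q ℕ.≤ separators x y ℕ.+ δᶠ x y ℕ.* (1 ℕ.+ q)
    1+q≤ x y with x ≟ᶠ y
    ... | yes _  = ≤-trans (≤-reflexive (sym (ℕₚ.*-identityˡ (1 ℕ.+ q)))) (ℕₚ.m≤n+m _ (separators x y))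
    ... | no x≢y = ≤-trans (ℕₚ.≤∧≢⇒< (≤-trans q≤s (index≤separators x≢y)) q≢) (ℕₚ.m≤m+n _ _)
      where
      arith : ∀ j → (2 ℕ.* j ℕ.+ 2) ℕ.+ 0 ≡ 2 ℕ.* (j ℕ.+ 1)
      arith = solve-∀

      regroup : ∀ c q → 1 ℕ.+ (2 ℕ.* c ℕ.+ q) ≡ (1 ℕ.+ 2 ℕ.* c) ℕ.+ q
      regroup = solve-∀

      q≢ : q ≢ separators x y
      -- With `q` separators, `parity` would read q + q = (1 + 2c) + q, making `q` = 2(j + 1) odd.
      q≢ q≡ = ℕₚ.even≢odd (j ℕ.+ 1) (commonOut x y) (trans (trans (sym (arith j)) (ℕₚ.+-identityʳ q))
        (ℕₚ.+-cancelʳ-≡ q _ _ (begin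
          q ℕ.+ q                                              ≡⟨ cong₂ ℕ._+_ (o≡q x) (o≡q y) ⟨
          outdegree x ℕ.+ outdegree y                          ≡⟨ parity x≢y ⟩
          1 ℕ.+ (2 ℕ.* commonOut x y ℕ.+ separators x y)       ≡⟨ cong (λ d → 1 ℕ.+ (2 ℕ.* commonOut x y ℕ.+ d)) q≡ ⟨
          1 ℕ.+ (2 ℕ.* commonOut x y ℕ.+ q)                    ≡⟨ regroup (commonOut x y) q ⟩
          (1 ℕ.+ 2 ℕ.* commonOut x y) ℕ.+ q                    ∎)))
        where open ≡-Reasoning

    ∑io : sum (λ z → indegree z ℕ.* outdegree z) ≡ n ℕ.* (q ℕ.* q)
    ∑io = trans (sum-cong-≗ (λ z → cong₂ ℕ._*_ (i≡q z) (o≡q z))) (sum-const n (q ℕ.* q))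

    inequality : n ℕ.* (n ℕ.* (1 ℕ.+ q)) ℕ.≤ 2 ℕ.* (n ℕ.* (q ℕ.* q)) ℕ.+ n ℕ.* (1 ℕ.+ q)
    inequality = begin
      n ℕ.* (n ℕ.* (1 ℕ.+ q))
        ≡⟨ trans (sum-cong-≗ {n} (λ _ → sum-const n (1 ℕ.+ q))) (sum-const n (n ℕ.* (1 ℕ.+ q))) ⟨
      sum {n} (λ _ → sum {n} (λ _ → 1 ℕ.+ q))
        ≤⟨ ∑bound≤ (λ _ _ → 1 ℕ.+ q) (1 ℕ.+ q) 1+q≤ ⟩
      2 ℕ.* sum (λ z → indegree z ℕ.* outdegree z) ℕ.+ n ℕ.* (1 ℕ.+ q)
        ≡⟨ cong (λ t → 2 ℕ.* t ℕ.+ n ℕ.* (1 ℕ.+ q)) ∑io ⟩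
      2 ℕ.* (n ℕ.* (q ℕ.* q)) ℕ.+ n ℕ.* (1 ℕ.+ q) ∎
      where open ℕₚ.≤-Reasoning

    impossible : ⊥
    impossible = exceeds (arith j)
      (subst (λ n → n ℕ.* (n ℕ.* (1 ℕ.+ q)) ℕ.≤ 2 ℕ.* (n ℕ.* (q ℕ.* q)) ℕ.+ n ℕ.* (1 ℕ.+ q)) n≡ inequality)
      where
      -- As n = 2q + 1, the two sides of `inequality` differ by 2qn; the last summand is 2qn - 1,
      -- expanded in `j`.
      arith : ∀ j → let n = 4 ℕ.* j ℕ.+ 5 ; q = 2 ℕ.* j ℕ.+ 2 in
        n ℕ.* (n ℕ.* (1 ℕ.+ q))
          ≡ 1 ℕ.+ ((2 ℕ.* (n ℕ.* (q ℕ.* q)) ℕ.+ n ℕ.* (1 ℕ.+ q)) ℕ.+ (16 ℕ.* j ℕ.* j ℕ.+ 36 ℕ.* j ℕ.+ 19))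
      arith = solve-∀

  -- Order 4k: two out-degrees, each taken by half of the vertices

  module NearRegular (j : ℕ) (n≡ : n ≡ 4 ℕ.* j ℕ.+ 4) (m≤s : 1 ℕ.+ 2 ℕ.* j ℕ.≤ s) where

    m : ℕ
    m = 1 ℕ.+ 2 ℕ.* j

    -- The indicators of out-degree 2k and 2k - 1, where k = j + 1 and m = 2k - 1;
    -- hence mixed below is the indicator of distinct out-degrees.
    hi lo : Fin n → ℕ
    hi x = outdegree x ℕ.∸ m
    lo x = indegree x ℕ.∸ m

    o≡ : ∀ x → outdegree x ≡ m ℕ.+ hi x
    o≡ x = sym (ℕₚ.m+[n∸m]≡n (≤-trans m≤s (index≤outdegree x)))

    i≡ : ∀ x → indegree x ≡ m ℕ.+ lo x
    i≡ x = sym (ℕₚ.m+[n∸m]≡n (≤-trans m≤s (index≤indegree x)))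

    -- The two degrees add up to n - 1 = 2m + 1 and neither is below `m`, so exactly one of them
    -- exceeds `m`, and by one.
    hi+lo : ∀ x → hi x ℕ.+ lo x ≡ 1
    hi+lo x = ℕₚ.+-cancelˡ-≡ (1 ℕ.+ (m ℕ.+ m)) _ _ (begin
      (1 ℕ.+ (m ℕ.+ m)) ℕ.+ (hi x ℕ.+ lo x)    ≡⟨ regroup m (hi x) (lo x) ⟩
      1 ℕ.+ ((m ℕ.+ hi x) ℕ.+ (m ℕ.+ lo x))    ≡⟨ cong₂ (λ o i → 1 ℕ.+ (o ℕ.+ i)) (o≡ x) (i≡ x) ⟨
      1 ℕ.+ (outdegree x ℕ.+ indegree x)       ≡⟨ trans (degrees x) n≡ ⟩
      4 ℕ.* j ℕ.+ 4                            ≡⟨ arith j ⟩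
      (1 ℕ.+ (m ℕ.+ m)) ℕ.+ 1                  ∎)
      where
      open ≡-Reasoning
      regroup : ∀ m h l → (1 ℕ.+ (m ℕ.+ m)) ℕ.+ (h ℕ.+ l) ≡ 1 ℕ.+ ((m ℕ.+ h) ℕ.+ (m ℕ.+ l))
      regroup = solve-∀
      arith : ∀ j → 4 ℕ.* j ℕ.+ 4 ≡ (1 ℕ.+ ((1 ℕ.+ 2 ℕ.* j) ℕ.+ (1 ℕ.+ 2 ℕ.* j))) ℕ.+ 1
      arith = solve-∀

    hi*lo : ∀ x → hi x ℕ.* lo x ≡ 0
    hi*lo x with hi x | lo x | hi+lo x
    ... | 0     | _ | _    = refl
    ... | 1     | 0 | _    = refl

    -- For distinct out-degrees the degree sum is 2m + 1, so with `m` separators `parity` would give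
    -- m = 2c, although m = 1 + 2j is odd.
    m≢separators : ∀ {x y} → x ≢ y → hi x ℕ.+ hi y ≡ 1 → m ≢ separators x y
    m≢separators {x} {y} x≢y h+h m≡ = ℕₚ.even≢odd (commonOut x y) j (sym
      (ℕₚ.+-cancelˡ-≡ (1 ℕ.+ m) _ _ (begin
        (1 ℕ.+ m) ℕ.+ m                                 ≡⟨ ℕₚ.+-comm 1 (m ℕ.+ m) ⟩
        (m ℕ.+ m) ℕ.+ 1                                 ≡⟨ cong ((m ℕ.+ m) ℕ.+_) h+h ⟨
        (m ℕ.+ m) ℕ.+ (hi x ℕ.+ hi y)                   ≡⟨ regroup m (hi x) (hi y) ⟩
        (m ℕ.+ hi x) ℕ.+ (m ℕ.+ hi y)                   ≡⟨ cong₂ ℕ._+_ (o≡ x) (o≡ y) ⟨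
        outdegree x ℕ.+ outdegree y                     ≡⟨ parity x≢y ⟩
        1 ℕ.+ (2 ℕ.* commonOut x y ℕ.+ separators x y)  ≡⟨ cong (λ d → 1 ℕ.+ (2 ℕ.* commonOut x y ℕ.+ d)) m≡ ⟨
        1 ℕ.+ (2 ℕ.* commonOut x y ℕ.+ m)               ≡⟨ cong suc (ℕₚ.+-comm (2 ℕ.* commonOut x y) m) ⟩
        (1 ℕ.+ m) ℕ.+ 2 ℕ.* commonOut x y               ∎)))
      where
      open ≡-Reasoning
      regroup : ∀ m h h′ → (m ℕ.+ m) ℕ.+ (h ℕ.+ h′) ≡ (m ℕ.+ h) ℕ.+ (m ℕ.+ h′)
      regroup = solve-∀

    mixed : Fin n → Fin n → ℕ
    mixed x y = hi x ℕ.* lo y ℕ.+ lo x ℕ.* hi y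

    m+mixed≤separators : ∀ {x y} → x ≢ y → m ℕ.+ mixed x y ℕ.≤ separators x y
    m+mixed≤separators {x} {y} x≢y
      -- Abstracting `m≢separators` together with the indicators reduces its hypothesis to `1 ≡ 1`
      -- in the two mixed cases, where it makes the bound strict.
      with hi x | lo x | hi y | lo y | hi+lo x | hi+lo y | m≢separators {x} {y} x≢y
    ... | 0 | 1 | 0 | 1 | _ | _ | _  = ≤-trans (≤-reflexive (ℕₚ.+-identityʳ m)) m≤
      where m≤ = ≤-trans m≤s (index≤separators x≢y)
    ... | 1 | 0 | 1 | 0 | _ | _ | _  = ≤-trans (≤-reflexive (ℕₚ.+-identityʳ m)) m≤
      where m≤ = ≤-trans m≤s (index≤separators x≢y)
    ... | 0 | 1 | 1 | 0 | _ | _ | m≢ = ≤-trans (≤-reflexive (ℕₚ.+-comm m 1)) (ℕₚ.≤∧≢⇒< m≤ (m≢ refl))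
      where m≤ = ≤-trans m≤s (index≤separators x≢y)
    ... | 1 | 0 | 0 | 1 | _ | _ | m≢ = ≤-trans (≤-reflexive (ℕₚ.+-comm m 1)) (ℕₚ.≤∧≢⇒< m≤ (m≢ refl))
      where m≤ = ≤-trans m≤s (index≤separators x≢y)

    m+mixed≤ : ∀ x y → m ℕ.+ mixed x y ℕ.≤ separators x y ℕ.+ δᶠ x y ℕ.* m
    m+mixed≤ x y with x ≟ᶠ y
    ... | no x≢y   = ≤-trans (m+mixed≤separators x≢y) (ℕₚ.m≤m+n _ _)
    -- `mixed x x` vanishes by `hi*lo`, so the slack `m` covers the diagonal.
    ... | yes refl = ≤-trans (≤-reflexive (begin
        m ℕ.+ (hi x ℕ.* lo x ℕ.+ lo x ℕ.* hi x)
          ≡⟨ cong (m ℕ.+_) (cong₂ ℕ._+_ (hi*lo x) (trans (ℕₚ.*-comm (lo x) (hi x)) (hi*lo x))) ⟩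
        m ℕ.+ 0
          ≡⟨ ℕₚ.+-comm m 0 ⟩
        m
          ≡⟨ ℕₚ.*-identityˡ m ⟨
        1 ℕ.* m ∎)) (ℕₚ.m≤n+m _ (separators x x))
      where open ≡-Reasoning

    H L : ℕ
    H = sum hi
    L = sum lo

    ∑shift : (f g : Fin n → ℕ) → (∀ x → f x ≡ m ℕ.+ g x) → sum f ≡ n ℕ.* m ℕ.+ sum g
    ∑shift f g f≡ = begin
      sum f                              ≡⟨ sum-cong-≗ f≡ ⟩
      sum (λ x → m ℕ.+ g x)              ≡⟨ ∑-distrib-+ (const m) g ⟩
      sum {n} (const m) ℕ.+ sum g        ≡⟨ cong (ℕ._+ sum g) (sum-const n m) ⟩
      n ℕ.* m ℕ.+ sum g                  ∎
      where open ≡-Reasoning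

    -- Out-degrees and in-degrees have the same total, and both totals contain the same `n ℕ.* m`.
    H≡L : H ≡ L
    H≡L = ℕₚ.+-cancelˡ-≡ (n ℕ.* m) _ _
      (trans (sym (∑shift outdegree hi o≡)) (trans ∑outdegree≡∑indegree (∑shift indegree lo i≡)))

    L≡1+m : L ≡ 1 ℕ.+ m
    L≡1+m = ℕₚ.*-cancelˡ-≡ L (1 ℕ.+ m) 2 (begin
      2 ℕ.* L                      ≡⟨ cong (L ℕ.+_) (ℕₚ.+-identityʳ L) ⟩
      L ℕ.+ L                      ≡⟨ cong (ℕ._+ L) H≡L ⟨
      H ℕ.+ L                      ≡⟨ ∑-distrib-+ hi lo ⟨
      sum (λ x → hi x ℕ.+ lo x)    ≡⟨ sum-cong-≗ hi+lo ⟩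
      sum {n} (const 1)            ≡⟨ sum-const n 1 ⟩
      n ℕ.* 1                      ≡⟨ ℕₚ.*-identityʳ n ⟩
      n                            ≡⟨ n≡ ⟩
      4 ℕ.* j ℕ.+ 4                ≡⟨ arith j ⟩
      2 ℕ.* (1 ℕ.+ m)              ∎)
      where
      open ≡-Reasoning
      arith : ∀ j → 4 ℕ.* j ℕ.+ 4 ≡ 2 ℕ.* (1 ℕ.+ (1 ℕ.+ 2 ℕ.* j))
      arith = solve-∀

    ∑io : sum (λ z → indegree z ℕ.* outdegree z) ≡ n ℕ.* (m ℕ.* m ℕ.+ m)
    ∑io = trans (sum-cong-≗ io) (sum-const n (m ℕ.* m ℕ.+ m))
      where
      open ≡-Reasoning
      expand : ∀ m h l → (m ℕ.+ l) ℕ.* (m ℕ.+ h) ≡ m ℕ.* m ℕ.+ m ℕ.* (h ℕ.+ l) ℕ.+ h ℕ.* l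
      expand = solve-∀
      collapse : ∀ m → m ℕ.* m ℕ.+ m ℕ.* 1 ℕ.+ 0 ≡ m ℕ.* m ℕ.+ m
      collapse = solve-∀
      io : ∀ z → indegree z ℕ.* outdegree z ≡ m ℕ.* m ℕ.+ m
      io z = begin
        indegree z ℕ.* outdegree z
          ≡⟨ cong₂ ℕ._*_ (i≡ z) (o≡ z) ⟩
        (m ℕ.+ lo z) ℕ.* (m ℕ.+ hi z)
          ≡⟨ expand m (hi z) (lo z) ⟩
        m ℕ.* m ℕ.+ m ℕ.* (hi z ℕ.+ lo z) ℕ.+ hi z ℕ.* lo z
          ≡⟨ cong₂ (λ a b → m ℕ.* m ℕ.+ m ℕ.* a ℕ.+ b) (hi+lo z) (hi*lo z) ⟩
        m ℕ.* m ℕ.+ m ℕ.* 1 ℕ.+ 0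
          ≡⟨ collapse m ⟩
        m ℕ.* m ℕ.+ m ∎

    -- Both terms of `mixed` are products of a function of `x` and a function of `y`, so their
    -- double sums factor.
    ∑mixed : sum (λ x → sum (λ y → m ℕ.+ mixed x y)) ≡ n ℕ.* (n ℕ.* m) ℕ.+ (H ℕ.* L ℕ.+ L ℕ.* H)
    ∑mixed = begin
      sum (λ x → sum (λ y → m ℕ.+ mixed x y))
        ≡⟨ sum-cong-≗ (λ x → ∑shift (λ y → m ℕ.+ mixed x y) (mixed x) (λ _ → refl)) ⟩
      sum (λ x → n ℕ.* m ℕ.+ sum (mixed x))
        ≡⟨ ∑-distrib-+ {n} (const (n ℕ.* m)) (λ x → sum (mixed x)) ⟩
      sum {n} (const (n ℕ.* m)) ℕ.+ sum (λ x → sum (mixed x))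
        ≡⟨ cong₂ ℕ._+_ (sum-const n (n ℕ.* m)) (sum-cong-≗ (λ x →
             ∑-distrib-+ (λ y → hi x ℕ.* lo y) (λ y → lo x ℕ.* hi y))) ⟩
      n ℕ.* (n ℕ.* m) ℕ.+ sum (λ x → sum (λ y → hi x ℕ.* lo y) ℕ.+ sum (λ y → lo x ℕ.* hi y))
        ≡⟨ cong (n ℕ.* (n ℕ.* m) ℕ.+_) (∑-distrib-+ (λ x → sum (λ y → hi x ℕ.* lo y)) (λ x → sum (λ y → lo x ℕ.* hi y))) ⟩
      n ℕ.* (n ℕ.* m) ℕ.+ (sum (λ x → sum (λ y → hi x ℕ.* lo y)) ℕ.+ sum (λ x → sum (λ y → lo x ℕ.* hi y)))
        ≡⟨ cong (n ℕ.* (n ℕ.* m) ℕ.+_) (cong₂ ℕ._+_ (sum-product hi lo) (sum-product lo hi)) ⟩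
      n ℕ.* (n ℕ.* m) ℕ.+ (H ℕ.* L ℕ.+ L ℕ.* H) ∎
      where open ≡-Reasoning

    inequality : n ℕ.* (n ℕ.* m) ℕ.+ ((1 ℕ.+ m) ℕ.* (1 ℕ.+ m) ℕ.+ (1 ℕ.+ m) ℕ.* (1 ℕ.+ m))
                 ℕ.≤ 2 ℕ.* (n ℕ.* (m ℕ.* m ℕ.+ m)) ℕ.+ n ℕ.* m
    inequality = begin
      n ℕ.* (n ℕ.* m) ℕ.+ ((1 ℕ.+ m) ℕ.* (1 ℕ.+ m) ℕ.+ (1 ℕ.+ m) ℕ.* (1 ℕ.+ m))
        ≡⟨ cong₂ (λ h l → n ℕ.* (n ℕ.* m) ℕ.+ (h ℕ.* l ℕ.+ l ℕ.* h)) (trans H≡L L≡1+m) L≡1+m ⟨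
      n ℕ.* (n ℕ.* m) ℕ.+ (H ℕ.* L ℕ.+ L ℕ.* H)
        ≡⟨ ∑mixed ⟨
      sum (λ x → sum (λ y → m ℕ.+ mixed x y))
        ≤⟨ ∑bound≤ (λ x y → m ℕ.+ mixed x y) m m+mixed≤ ⟩
      2 ℕ.* sum (λ z → indegree z ℕ.* outdegree z) ℕ.+ n ℕ.* m
        ≡⟨ cong (λ t → 2 ℕ.* t ℕ.+ n ℕ.* m) ∑io ⟩
      2 ℕ.* (n ℕ.* (m ℕ.* m ℕ.+ m)) ℕ.+ n ℕ.* m ∎
      where open ℕₚ.≤-Reasoning

    impossible : ⊥
    impossible = exceeds (arith j)
      (subst (λ n → n ℕ.* (n ℕ.* m) ℕ.+ ((1 ℕ.+ m) ℕ.* (1 ℕ.+ m) ℕ.+ (1 ℕ.+ m) ℕ.* (1 ℕ.+ m))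
                    ℕ.≤ 2 ℕ.* (n ℕ.* (m ℕ.* m ℕ.+ m)) ℕ.+ n ℕ.* m) n≡ inequality)
      where
      -- As n = 2(1 + m), the two sides of `inequality` differ by exactly n; the last summand is n -
      -- 1 = 4j + 3.
      arith : ∀ j → let n = 4 ℕ.* j ℕ.+ 4 ; m = 1 ℕ.+ 2 ℕ.* j in
        n ℕ.* (n ℕ.* m) ℕ.+ ((1 ℕ.+ m) ℕ.* (1 ℕ.+ m) ℕ.+ (1 ℕ.+ m) ℕ.* (1 ℕ.+ m))
          ≡ 1 ℕ.+ ((2 ℕ.* (n ℕ.* (m ℕ.* m ℕ.+ m)) ℕ.+ n ℕ.* m) ℕ.+ (4 ℕ.* j ℕ.+ 3))
      arith = solve-∀

  -- The three residue classes, with k = j + 1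

  index-4j+6 : ∀ j → n ≡ 4 ℕ.* j ℕ.+ 6 → s ℕ.≤ 2 ℕ.* j ℕ.+ 2
  -- An index above 2k would force both degrees of a vertex to be at least 2k + 1, hence n to be at
  -- least 4k + 3.
  index-4j+6 j n≡ = ℕₚ.≮⇒≥ λ q≤s → exceeds {c = 0} (arith j)
    (subst (1 ℕ.+ ((1 ℕ.+ (2 ℕ.* j ℕ.+ 2)) ℕ.+ (1 ℕ.+ (2 ℕ.* j ℕ.+ 2))) ℕ.≤_)
      (trans (degrees x) n≡)
      (s≤s (+-mono-≤ (≤-trans q≤s (index≤outdegree x)) (≤-trans q≤s (index≤indegree x)))))
    where
    x : Fin n
    x = vertex 3≤n

    arith : ∀ j → 1 ℕ.+ ((1 ℕ.+ (2 ℕ.* j ℕ.+ 2)) ℕ.+ (1 ℕ.+ (2 ℕ.* j ℕ.+ 2)))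
                ≡ 1 ℕ.+ (4 ℕ.* j ℕ.+ 6 ℕ.+ 0)
    arith = solve-∀

  index-4j+5 : ∀ j → n ≡ 4 ℕ.* j ℕ.+ 5 → s ℕ.≤ 2 ℕ.* j ℕ.+ 1
  index-4j+5 j n≡ = ℕₚ.≮⇒≥ λ q≤s →
    Regular.impossible j n≡ (≤-trans (≤-reflexive (ℕₚ.+-suc (2 ℕ.* j) 1)) q≤s)

  index-4j+4 : ∀ j → n ≡ 4 ℕ.* j ℕ.+ 4 → s ℕ.≤ 2 ℕ.* j
  index-4j+4 j n≡ = ℕₚ.≮⇒≥ (NearRegular.impossible j n≡)

-- From integer k to natural numbers

quotient-positive : ∀ {n} → 3 ℕ.≤ n → (k : ℤ) (r : ℕ) → r ℕ.≤ 2 → + n ≡ + 4 * k + + r →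
  ∃[ j ] k ≡ + suc j × n ≡ 4 ℕ.* j ℕ.+ (4 ℕ.+ r)
quotient-positive {n} 3≤n k r r≤2 n≡ = positive k n≡
  where
  n≰r : ¬ n ℕ.≤ r
  n≰r n≤r = ℕₚ.<-irrefl refl (≤-trans 3≤n (≤-trans n≤r r≤2))

  arith : ∀ j r → 4 ℕ.* (1 ℕ.+ j) ℕ.+ r ≡ 4 ℕ.* j ℕ.+ (4 ℕ.+ r)
  arith = solve-∀

  positive : ∀ k → + n ≡ + 4 * k + + r → ∃[ j ] k ≡ + suc j × n ≡ 4 ℕ.* j ℕ.+ (4 ℕ.+ r)
  positive (+ suc j) n≡ = j , refl , trans (+-injective n≡) (arith j r)
  positive (+ zero)  n≡ = contradiction (≤-reflexive (+-injective n≡)) n≰r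
  -- For negative `k` the right side of the equation computes to `r ⊖ 4 ℕ.* suc j`, which is at most
  -- `r`.
  positive -[1+ j ]  n≡ = contradiction
    (ℤₚ.drop‿+≤+ (ℤₚ.≤-trans (ℤₚ.≤-reflexive n≡) (ℤₚ.m⊖n≤m r (4 ℕ.* suc j)))) n≰r

theorem1p1 : ∀ {n : ℕ} (T : Tournament n) (3≤n : 3 ℕ.≤ n) (k : ℤ) →
    (+ n ≡ + 4 * k + + 2 → + simplicityIndex T 3≤n ≤ + 2 * k) ×
    (+ n ≡ + 4 * k + + 1 → + simplicityIndex T 3≤n ≤ + 2 * k - + 1) ×
    (+ n ≡ + 4 * k → + simplicityIndex T 3≤n ≤ + 2 * k - + 2)
theorem1p1 {n} T 3≤n k = case₂ , case₁ , case₀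
  where
  open Reversal T 3≤n

  -- Brings two successors to the front, so that the integer subtractions of 1 and 2 in the bounds
  -- compute.
  double : ∀ j → 2 ℕ.* suc j ≡ 2 ℕ.+ 2 ℕ.* j
  double = ℕₚ.*-suc 2

  case₂ : + n ≡ + 4 * k + + 2 → + simplicityIndex T 3≤n ≤ + 2 * k
  case₂ n≡ with quotient-positive 3≤n k 2 ≤-refl n≡
  ... | j , refl , n≡′ = +≤+ (≤-trans (index-4j+6 j n≡′)
    (≤-reflexive (trans (ℕₚ.+-comm (2 ℕ.* j) 2) (sym (double j)))))

  case₁ : + n ≡ + 4 * k + + 1 → + simplicityIndex T 3≤n ≤ + 2 * k - + 1
  case₁ n≡ with quotient-positive 3≤n k 1 (s≤s z≤n) n≡
  ... | j , refl , n≡′ = subst (λ t → + simplicityIndex T 3≤n ≤ + t - + 1) (sym (double j))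
    (+≤+ (≤-trans (index-4j+5 j n≡′) (≤-reflexive (ℕₚ.+-comm (2 ℕ.* j) 1))))

  case₀ : + n ≡ + 4 * k → + simplicityIndex T 3≤n ≤ + 2 * k - + 2
  case₀ n≡ with quotient-positive 3≤n k 0 z≤n (trans n≡ (sym (ℤₚ.+-identityʳ (+ 4 * k))))
  ... | j , refl , n≡′ = subst (λ t → + simplicityIndex T 3≤n ≤ + t - + 2) (sym (double j))
    (+≤+ (index-4j+4 j n≡′))
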